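{- For every integer $n \ge 0$, let $$a(n) = \sum_{r=0}^n \frac{\operatorname{lcm}(n, n-1, n-2, \ldots, n-r+1)}{\operatorname{lcm}(1,2,3,\ldots,r)}.$$ Then $a(n) \equiv m(n) \pmod 2$ for all $n \ge 0$.
   Context: For a non-negative integer $k$, $s_2(k)$ denotes the number of ones in the binary expansion of $k$. Define $\bar{t}(k) = 1$ if $s_2(k)$ is even and $\bar{t}(k)=0$ if $s_2(k)$ is odd. The sequence $m(n)$, $n \ge 0$, is defined by $m(2k) = \bar{t}(k)$ and $m(2k+1) = 0$ for all $k \ge 0$. The least common multiple of the empty list is $1$, so the $r=0$ term of the sum is $1$; each term of the sum is an integer. The sequence $a(n)$ is OEIS A061297, indexed from $n=0$: $1,2,4,8,14,32,39,114,\ldots$. -}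

module Defs where

open import Data.Digit using (1b; toDigits)
import Data.Fin.Properties as Fin
open import Data.List.Base using (List; []; _∷_; applyUpTo; filter; foldr; length)
open import Data.List.Membership.Propositional using (_∈_)
open import Data.List.Membership.Propositional.Properties using (∈-applyUpTo⁺)
open import Data.List.Relation.Unary.All using (All; []; _∷_)
open import Data.List.Relation.Unary.All.Properties using (applyUpTo⁺₁; applyUpTo⁺₂)
open import Data.List.Relation.Unary.Any using (here; there)
open import Data.Nat.Base
open import Data.Nat.Divisibility
open import Data.Nat.DivMod using (m≡m%n+[m/n]*n; m%n<n)
open import Data.Nat.LCM using (lcm; m∣lcm[m,n]; n∣lcm[m,n]; lcm-least)
open import Data.Nat.ListAction using (sum)
open import Data.Nat.Properties
open import Data.Product.Base using (proj₁)
open import Relation.Binary.PropositionalEquality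
  using (_≡_; refl; sym; trans; cong; subst)
open import Relation.Nullary using (yes; no; contradiction)

s₂ : ℕ → ℕ
s₂ k = length (filter (Fin._≟ 1b) (proj₁ (toDigits 2 k)))

t̄ : ℕ → ℕ
t̄ k with 2 ∣? s₂ k
... | yes _ = 1
... | no _  = 0

m : ℕ → ℕ
m n with 2 ∣? n
... | yes (divides k _) = t̄ k
... | no _              = 0

m-even : ∀ k → m (2 * k) ≡ t̄ k
m-even k with 2 ∣? (2 * k)
... | yes (divides j 2k≡j2) =
  cong t̄ (*-cancelʳ-≡ j k 2 (trans (sym 2k≡j2) (*-comm 2 k)))
... | no 2∤2k               = contradiction (m∣m*n k) 2∤2k

m-odd : ∀ k → m (2 * k + 1) ≡ 0
m-odd k with 2 ∣? (2 * k + 1)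
... | no _    = refl
... | yes 2∣n = contradiction (∣m+n∣m⇒∣n 2∣n (m∣m*n k)) (>⇒∤ (s≤s (s≤s z≤n)))

lcms : List ℕ → ℕ
lcms = foldr lcm 1

∈⇒∣lcms : ∀ {x xs} → x ∈ xs → x ∣ lcms xs
∈⇒∣lcms {xs = y ∷ ys} (here refl) = m∣lcm[m,n] y (lcms ys)
∈⇒∣lcms {xs = y ∷ ys} (there x∈)  = ∣-trans (∈⇒∣lcms x∈) (n∣lcm[m,n] y (lcms ys))

lcms-least : ∀ {c xs} → All (_∣ c) xs → lcms xs ∣ c
lcms-least []         = 1∣ _
lcms-least (x∣ ∷ xs∣) = lcm-least x∣ (lcms-least xs∣)

lcms-nonZero : ∀ {xs} → All NonZero xs → NonZero (lcms xs)
lcms-nonZero []                    = _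
lcms-nonZero {x ∷ xs} (x≢0 ∷ xs≢0) = ≢-nonZero λ eq →
  ≢-nonZero⁻¹ (x * lcms xs) {{m*n≢0 x (lcms xs) {{x≢0}} {{lcms-nonZero xs≢0}}}}
    (0∣⇒≡0 (subst (_∣ x * lcms xs) eq
      (lcm-least {x} {lcms xs} (m∣m*n (lcms xs)) (n∣m*n x))))

-- lcm (n, n - 1, …, n - r + 1)
numerator : ℕ → ℕ → ℕ
numerator n r = lcms (applyUpTo (n ∸_) r)

-- lcm (1, 2, …, r)
denominator : ℕ → ℕ
denominator r = lcms (applyUpTo suc r)

denominator-nonZero : ∀ r → NonZero (denominator r)
denominator-nonZero r = lcms-nonZero (applyUpTo⁺₂ suc r λ _ → _)

-- Hence the division in term below is exact.
denominator∣numerator : ∀ n r → denominator r ∣ numerator n r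
denominator∣numerator n r = lcms-least (applyUpTo⁺₁ suc r λ {i} i<r →
  ∣-trans (divides (n / suc i) (n∸n%d i))
          (∈⇒∣lcms (∈-applyUpTo⁺ (n ∸_) (<-≤-trans (m%n<n n (suc i)) i<r))))
  where
  n∸n%d : ∀ i → n ∸ n % suc i ≡ n / suc i * suc i
  n∸n%d i = trans (cong (_∸ n % suc i) (m≡m%n+[m/n]*n n (suc i)))
                  (m+n∸m≡n (n % suc i) _)

term : ℕ → ℕ → ℕ
term n r = numerator n r / denominator r
  where instance _ = denominator-nonZero r

a : ℕ → ℕ
a n = sum (applyUpTo (term n) (suc n))

{-# OPTIONS --safe #-}
module Submission where

open import Defs
open import Data.Digit using (Bit; 0b; 1b; Expansion; fromDigits; toDigits)
open import Data.Fin.Base using (zero; suc; toℕ)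
import Data.Fin.Properties as Fin
open import Data.List.Base using ([]; _∷_; _∷ʳ_; applyUpTo; filter; length)
open import Data.List.Membership.Propositional.Properties using (∈-applyUpTo⁺)
open import Data.List.Properties using (applyUpTo-∷ʳ)
open import Data.List.Relation.Unary.Any using (Any; here; there)
open import Data.List.Relation.Unary.Any.Properties using (applyUpTo⁺; applyUpTo⁻)
open import Data.Nat.Base
open import Data.Nat.Coprimality using (Coprime; coprime-divisor)
open import Data.Nat.Divisibility
open import Data.Nat.DivMod
open import Data.Nat.GCD using (gcd)
open import Data.Nat.Induction using (<-rec)
open import Data.Nat.LCM using (lcm; lcm-least; gcd*lcm; m∣lcm[m,n]; n∣lcm[m,n])
open import Data.Nat.ListAction using (sum)
open import Data.Nat.ListAction.Properties using (sum-++)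
open import Data.Nat.Logarithm
  using (⌈log₂_⌉; ⌈log₂⌉-mono-≤; ⌈log₂⌈n/2⌉⌉≡⌈log₂n⌉∸1; ⌈log₂2*n⌉≡1+⌈log₂n⌉; ⌈log₂2^n⌉≡n)
open import Data.Nat.Primality
  using (Prime; prime[2]; prime⇒irreducible; prime⇒nonTrivial; prime⇒nonZero; euclidsLemma)
open import Data.Nat.Properties
open import Data.Product.Base using (∃; _×_; _,_; proj₁; proj₂)
open import Data.Sum.Base using (_⊎_; inj₁; inj₂; [_,_]′; map)
open import Function.Base using (_∘_; _$_; id)
open import Relation.Binary.Definitions using (tri<; tri≈; tri>)
open import Relation.Binary.PropositionalEquality
open import Relation.Nullary using (¬_; Dec; yes; no; contradiction)

-- Let 2^k ≤ r < 2^(k+1). The denominator of the r-th term is exactly divisible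
-- by 2^k, so the term is even iff one of n, n - 1, …, n - r + 1 is a multiple of
-- 2^(k+1), that is, iff n mod 2^(k+1) < r. Hence the terms r = 2q and r = 2q + 1
-- have the same parity when n is odd, while for n = 2j their parities differ
-- exactly when q = j mod 2^i, where i is the binary length of q. These q are the
-- truncations of the binary expansion of j at its ones, together with q = 0, so
-- there are 1 + s₂ j of them.

-- Prime powers and least common multiples

prime∤⇒coprime : ∀ {p n} → Prime p → p ∤ n → Coprime n p
prime∤⇒coprime pr p∤n (d∣n , d∣p) with prime⇒irreducible pr d∣p
... | inj₁ d≡1  = d≡1
... | inj₂ refl = contradiction d∣n p∤n

∣p^[1+k]*n⇒∣p^k*n : ∀ {p m} n k → Prime p → p ^ suc k ∤ m →
                    m ∣ p ^ suc k * n → m ∣ p ^ k * n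
∣p^[1+k]*n⇒∣p^k*n {p} {m} n k pr p^∤m m∣ with p ∣? m
... | no p∤m = coprime-divisor (prime∤⇒coprime pr p∤m)
                 (subst (m ∣_) (*-assoc p (p ^ k) n) m∣)
∣p^[1+k]*n⇒∣p^k*n {p} {m} n zero pr p^∤m m∣ | yes p∣m =
  contradiction (subst (_∣ m) (sym (*-identityʳ p)) p∣m) p^∤m
∣p^[1+k]*n⇒∣p^k*n {p} n (suc k) pr p^∤m m∣ | yes (divides m′ refl) =
  subst₂ _∣_ (*-comm p m′) (sym (*-assoc p (p ^ k) n)) $
    *-monoʳ-∣ p $ ∣p^[1+k]*n⇒∣p^k*n n k pr
      (λ p^∣m′ → p^∤m (subst (p ^ 2+ k ∣_) (*-comm p m′) (*-monoʳ-∣ p p^∣m′)))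
      (*-cancelˡ-∣ p {{prime⇒nonZero pr}}
        (subst₂ _∣_ (*-comm m′ p) (*-assoc p (p ^ suc k) n) m∣))

lcm≡0⇒≡0 : ∀ m n → lcm m n ≡ 0 → m ≡ 0 ⊎ n ≡ 0
lcm≡0⇒≡0 m n eq = m*n≡0⇒m≡0∨n≡0 m
  (trans (sym (gcd*lcm m n)) (trans (cong (gcd m n *_) eq) (*-zeroʳ (gcd m n))))

-- If p^(1+k) divided neither m nor n, then lcm m n / p would still be a common multiple.
p^k∣lcm⇒p^k∣ : ∀ {p} k m n → Prime p → p ^ k ∣ lcm m n → p ^ k ∣ m ⊎ p ^ k ∣ n
p^k∣lcm⇒p^k∣ zero m n pr _ = inj₁ (1∣ m)
p^k∣lcm⇒p^k∣ {p} (suc k) m n pr (divides c lcm≡c*p^) with p ^ suc k ∣? m | p ^ suc k ∣? n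
... | yes p^∣m | _        = inj₁ p^∣m
... | no _     | yes p^∣n = inj₂ p^∣n
... | no p^∤m  | no p^∤n  with c
...   | zero  = map divides0 divides0 (lcm≡0⇒≡0 m n lcm≡c*p^)
  where
  divides0 : ∀ {x} → x ≡ 0 → p ^ suc k ∣ x
  divides0 refl = _ ∣0
...   | c@(suc _) = contradiction p^∣p^ (>⇒∤ {{m^n≢0 p k {{prime⇒nonZero pr}}}} p^<p^)
  where
  lcm≡ : lcm m n ≡ p ^ suc k * c
  lcm≡ = trans lcm≡c*p^ (*-comm c _)
  reduce : ∀ {x} → p ^ suc k ∤ x → x ∣ lcm m n → x ∣ p ^ k * c
  reduce {x} p^∤x x∣ = ∣p^[1+k]*n⇒∣p^k*n c k pr p^∤x (subst (x ∣_) lcm≡ x∣)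
  p^∣p^ : p ^ suc k ∣ p ^ k
  p^∣p^ = *-cancelʳ-∣ c (subst (_∣ p ^ k * c) lcm≡
            (lcm-least (reduce p^∤m (m∣lcm[m,n] m n)) (reduce p^∤n (n∣lcm[m,n] m n))))
  p^<p^ : p ^ k < p ^ suc k
  p^<p^ = ^-monoʳ-< p (nonTrivial⇒n>1 p {{prime⇒nonTrivial pr}}) {k} {suc k} ≤-refl

-- The exponent is positive because `p ^ 0` divides the lcm of the empty list, which has no entry to
-- offer.
p^[1+k]∣lcms⇒Any : ∀ {p} k xs → Prime p → p ^ suc k ∣ lcms xs → Any (p ^ suc k ∣_) xs
p^[1+k]∣lcms⇒Any {p} k [] pr p^∣1 =
  contradiction (∣1⇒≡1 (m*n∣⇒m∣ p (p ^ k) p^∣1)) (nonTrivial⇒≢1 {{prime⇒nonTrivial pr}})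
p^[1+k]∣lcms⇒Any k (x ∷ xs) pr p^∣ =
  [ here , there ∘ p^[1+k]∣lcms⇒Any k xs pr ]′ (p^k∣lcm⇒p^k∣ (suc k) x (lcms xs) pr p^∣)

Any⇒∣lcms : ∀ {d xs} → Any (d ∣_) xs → d ∣ lcms xs
Any⇒∣lcms {xs = x ∷ xs} (here d∣x)  = ∣-trans d∣x (m∣lcm[m,n] x (lcms xs))
Any⇒∣lcms {xs = x ∷ xs} (there d∣) = ∣-trans (Any⇒∣lcms d∣) (n∣lcm[m,n] x (lcms xs))

-- Binary length and truncation

-- The number of binary digits of `n`, that is, the least `i` with `n < 2 ^ i`; thus `bits 0` is
-- `0`.
bits : ℕ → ℕ
bits n = ⌈log₂ suc n ⌉

⌈log₂[2+n]⌉≡1+⌈log₂⌈[2+n]/2⌉⌉ : ∀ n → ⌈log₂ 2+ n ⌉ ≡ suc ⌈log₂ ⌈ 2+ n /2⌉ ⌉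
⌈log₂[2+n]⌉≡1+⌈log₂⌈[2+n]/2⌉⌉ n = begin
  ⌈log₂ 2+ n ⌉               ≡⟨ m+[n∸m]≡n (⌈log₂⌉-mono-≤ {2} {2+ n} (s≤s (s≤s z≤n))) ⟨
  suc (⌈log₂ 2+ n ⌉ ∸ 1)     ≡⟨ cong suc (⌈log₂⌈n/2⌉⌉≡⌈log₂n⌉∸1 (2+ n)) ⟨
  suc ⌈log₂ ⌈ 2+ n /2⌉ ⌉     ∎
  where open ≡-Reasoning

n*2≡n+n : ∀ n → n * 2 ≡ n + n
n*2≡n+n n = trans (*-comm n 2) (cong (n +_) (+-identityʳ n))

bits-even : ∀ n → bits (suc n * 2) ≡ suc (bits (suc n))
bits-even n = trans (⌈log₂[2+n]⌉≡1+⌈log₂⌈[2+n]/2⌉⌉ (suc (n * 2)))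
  (cong (λ i → suc ⌈log₂ suc (suc i) ⌉) (trans (cong ⌊_/2⌋ (n*2≡n+n n)) (sym (n≡⌊n+n/2⌋ n))))

bits-odd : ∀ n → bits (suc (n * 2)) ≡ suc (bits n)
bits-odd n = trans (cong ⌈log₂_⌉ (*-comm (suc n) 2)) (⌈log₂2*n⌉≡1+⌈log₂n⌉ (suc n))

n≤2^⌈log₂n⌉ : ∀ n → n ≤ 2 ^ ⌈log₂ n ⌉
n≤2^⌈log₂n⌉ = <-rec _ go
  where
  open ≤-Reasoning
  go : ∀ n → (∀ {k} → k < n → k ≤ 2 ^ ⌈log₂ k ⌉) → n ≤ 2 ^ ⌈log₂ n ⌉
  go 0 _ = z≤n
  go 1 _ = ≤-refl
  go n@(2+ n′) rec = begin
    n                          ≡⟨ ⌊n/2⌋+⌈n/2⌉≡n n ⟨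
    ⌊ n /2⌋ + ⌈ n /2⌉          ≤⟨ +-monoˡ-≤ ⌈ n /2⌉ (⌊n/2⌋≤⌈n/2⌉ n) ⟩
    ⌈ n /2⌉ + ⌈ n /2⌉          ≡⟨ cong (⌈ n /2⌉ +_) (+-identityʳ _) ⟨
    2 * ⌈ n /2⌉                ≤⟨ *-monoʳ-≤ 2 (rec (⌈n/2⌉<n n′)) ⟩
    2 ^ suc ⌈log₂ ⌈ n /2⌉ ⌉    ≡⟨ cong (2 ^_) (⌈log₂[2+n]⌉≡1+⌈log₂⌈[2+n]/2⌉⌉ n′) ⟨
    2 ^ ⌈log₂ n ⌉              ∎

k<bits⇒2^k≤ : ∀ {k n} → k < bits n → 2 ^ k ≤ n
k<bits⇒2^k≤ {k} k<bits = ≮⇒≥ λ n<2^k →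
  <⇒≱ k<bits (≤-trans (⌈log₂⌉-mono-≤ n<2^k) (≤-reflexive (⌈log₂2^n⌉≡n k)))

infixl 7 _mod2^_

-- The number formed by the `k` lowest binary digits of `n`. The nonzero instance is fixed inside,
-- so equations between exponents apply by `cong`.
_mod2^_ : ℕ → ℕ → ℕ
n mod2^ k = (n % 2 ^ k) {{m^n≢0 2 k}}

mod2^≤ : ∀ n k → n mod2^ k ≤ n
mod2^≤ n k = m%n≤m n (2 ^ k) {{m^n≢0 2 k}}

mod2^-suc : ∀ (d : Bit) n k → (toℕ d + n * 2) mod2^ suc k ≡ toℕ d + n mod2^ k * 2
mod2^-suc d n k = begin
  (toℕ d + n * 2) % 2 ^ suc k      ≡⟨ cong (_% 2 ^ suc k) (+-comm (toℕ d) (n * 2)) ⟩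
  (n * 2 + toℕ d) % 2 ^ suc k      ≡⟨ %-congʳ {m = 2 ^ suc k} (*-comm 2 (2 ^ k)) ⟩
  (n * 2 + toℕ d) % (2 ^ k * 2)    ≡⟨ [m*n+o]%[p*n]≡[m*n]%[p*n]+o n (2 ^ k) (Fin.toℕ<n d) ⟩
  (n * 2) % (2 ^ k * 2) + toℕ d    ≡⟨ cong (_+ toℕ d) (m%n*o≡m*o%[n*o] n (2 ^ k) 2) ⟨
  n mod2^ k * 2 + toℕ d            ≡⟨ +-comm _ (toℕ d) ⟩
  toℕ d + n mod2^ k * 2            ∎
  where
  open ≡-Reasoning
  instance
    2^k≢0 : NonZero (2 ^ k)
    2^k≢0 = m^n≢0 2 k
    2^[1+k]≢0 : NonZero (2 ^ suc k)
    2^[1+k]≢0 = m^n≢0 2 (suc k)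
    2^k*2≢0 : NonZero (2 ^ k * 2)
    2^k*2≢0 = m*n≢0 (2 ^ k) 2

-- Parity of the terms

module _ (n d : ℕ) .{{_ : NonZero d}} where

  -- Going down from `n`, the first multiple of `d` is met after `n % d` steps.
  window-multiple⇒%< : ∀ {r} → ∃ (λ i → i < r × d ∣ n ∸ i) → n % d < r
  window-multiple⇒%< (i , i<r , d∣n∸i) with ≤-total i n
  ... | inj₁ i≤n = ≤-<-trans (≤-trans (≤-reflexive n%d≡i%d) (m%n≤m i d)) i<r
    where
    n%d≡i%d : n % d ≡ i % d
    n%d≡i%d = trans (cong (_% d) (sym (m∸n+n≡m i≤n))) (%-remove-+ˡ i d∣n∸i)
  -- Here `n ∸ i` is `0`, so its divisibility says nothing; `n % d ≤ n ≤ i` suffices.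
  ... | inj₂ n≤i = ≤-<-trans (≤-trans (m%n≤m n d) n≤i) i<r

  %<⇒window-multiple : ∀ {r} → n % d < r → ∃ λ i → i < r × d ∣ n ∸ i
  %<⇒window-multiple n%d<r = n % d , n%d<r , divides (n / d)
    (trans (cong (_∸ n % d) (m≡m%n+[m/n]*n n d)) (m+n∸m≡n (n % d) _))

2^k∣denominator : ∀ {k r} → 2 ^ k ≤ r → 2 ^ k ∣ denominator r
-- The entries of the list have the form `suc i`, so `2 ^ k` has to be exhibited as a successor.
2^k∣denominator {k} 2^k≤r with 2 ^ k in eq
... | zero  = contradiction eq (≢-nonZero⁻¹ (2 ^ k) {{m^n≢0 2 k}})
... | suc _ = ∈⇒∣lcms (∈-applyUpTo⁺ suc 2^k≤r)

2^[1+k]∤denominator : ∀ {k r} → r < 2 ^ suc k → 2 ^ suc k ∤ denominator r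
2^[1+k]∤denominator {k} r<2^ 2^∣den =
  let i , i<r , 2^∣i = applyUpTo⁻ suc (p^[1+k]∣lcms⇒Any k _ prime[2] 2^∣den)
  in contradiction 2^∣i (>⇒∤ (<-≤-trans (s≤s i<r) r<2^))

2^[1+k]∣numerator⇒ : ∀ n k r → 2 ^ suc k ∣ numerator n r → n mod2^ suc k < r
2^[1+k]∣numerator⇒ n k r 2^∣ = window-multiple⇒%< n (2 ^ suc k) {{m^n≢0 2 (suc k)}}
  (applyUpTo⁻ (n ∸_) (p^[1+k]∣lcms⇒Any k _ prime[2] 2^∣))

⇒2^[1+k]∣numerator : ∀ n k r → n mod2^ suc k < r → 2 ^ suc k ∣ numerator n r
⇒2^[1+k]∣numerator n k r <r =
  let i , i<r , 2^∣ = %<⇒window-multiple n (2 ^ suc k) {{m^n≢0 2 (suc k)}} <r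
  in Any⇒∣lcms (applyUpTo⁺ (n ∸_) 2^∣ i<r)

term*denominator : ∀ n r → term n r * denominator r ≡ numerator n r
term*denominator n r = m/n*n≡m {{denominator-nonZero r}} (denominator∣numerator n r)

module _ {k r : ℕ} (2^k≤r : 2 ^ k ≤ r) (r<2^ : r < 2 ^ suc k) (n : ℕ) where

  2∣term⇒ : 2 ∣ term n r → n mod2^ suc k < r
  2∣term⇒ 2∣t = 2^[1+k]∣numerator⇒ n k r (subst (2 ^ suc k ∣_) (term*denominator n r)
    (*-pres-∣ 2∣t (2^k∣denominator {k} 2^k≤r)))

  ⇒2∣term : n mod2^ suc k < r → 2 ∣ term n r
  ⇒2∣term <r with 2^k∣denominator {k} 2^k≤r
  ... | divides c den≡ =
    -- Cancelling `2 ^ k` from the numerator leaves an even `term n r * c`, where the cofactor `c`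
    -- of the denominator is odd.
    [ id , (λ 2∣c → contradiction (2^∣den 2∣c) (2^[1+k]∤denominator {k} r<2^)) ]′
      (euclidsLemma (term n r) c prime[2] (*-cancelʳ-∣ (2 ^ k) {{m^n≢0 2 k}} 2^∣t*c*2^k))
    where
    2^∣den : 2 ∣ c → 2 ^ suc k ∣ denominator r
    2^∣den 2∣c = subst (2 ^ suc k ∣_) (sym den≡) (*-monoˡ-∣ (2 ^ k) 2∣c)
    2^∣t*c*2^k : 2 ^ suc k ∣ term n r * c * 2 ^ k
    2^∣t*c*2^k = subst (2 ^ suc k ∣_)
      (trans (sym (term*denominator n r))
        (trans (cong (term n r *_) den≡) (sym (*-assoc (term n r) c (2 ^ k)))))
      (⇒2^[1+k]∣numerator n k r <r)

𝟙 : ∀ {P : Set} → Dec P → ℕ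
𝟙 (yes _) = 1
𝟙 (no _)  = 0

𝟙-cong : ∀ {P Q : Set} → (P → Q) → (Q → P) → (p? : Dec P) (q? : Dec Q) → 𝟙 p? ≡ 𝟙 q?
𝟙-cong f g (yes p) (yes q) = refl
𝟙-cong f g (yes p) (no ¬q) = contradiction (f p) ¬q
𝟙-cong f g (no ¬p) (yes q) = contradiction (g q) ¬p
𝟙-cong f g (no ¬p) (no ¬q) = refl

𝟙-yes : ∀ {P : Set} → P → (p? : Dec P) → 𝟙 p? ≡ 1
𝟙-yes p (yes _) = refl
𝟙-yes p (no ¬p) = contradiction p ¬p

𝟙-no : ∀ {P : Set} → ¬ P → (p? : Dec P) → 𝟙 p? ≡ 0
𝟙-no ¬p (yes p) = contradiction p ¬p
𝟙-no ¬p (no _)  = refl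

2∤⇒%2≡1 : ∀ n → 2 ∤ n → n % 2 ≡ 1
2∤⇒%2≡1 n 2∤n with n % 2 in eq | m%n<n n 2
... | 0 | _ = contradiction (m%n≡0⇒n∣m n 2 eq) 2∤n
... | 1 | _ = refl
... | 2+ _ | s≤s (s≤s ())

-- The parity of `term n r`. For `r = 0` the modulus is `1` and the value is `1`, which agrees with
-- the quotient of two empty lcms.
oddTerm : ℕ → ℕ → ℕ
oddTerm n r = 𝟙 (r ≤? n mod2^ bits r)

term%2 : ∀ n r → term n r % 2 ≡ oddTerm n r
term%2 n zero = sym (𝟙-yes z≤n (0 ≤? n mod2^ bits 0))
term%2 n r@(suc r′) = trans term%2′ (cong (λ i → 𝟙 (r ≤? n mod2^ i)) (sym bits≡))
  where
  k : ℕ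
  -- The exponent with `2 ^ k ≤ r < 2 ^ suc k`, one less than the binary length of `r`.
  k = ⌈log₂ ⌈ 2+ r′ /2⌉ ⌉
  bits≡ : bits r ≡ suc k
  bits≡ = ⌈log₂[2+n]⌉≡1+⌈log₂⌈[2+n]/2⌉⌉ r′
  2^k≤r : 2 ^ k ≤ r
  2^k≤r = k<bits⇒2^k≤ (≤-reflexive (sym bits≡))
  r<2^ : r < 2 ^ suc k
  r<2^ = subst (λ i → r < 2 ^ i) bits≡ (n≤2^⌈log₂n⌉ (suc r))
  term%2′ : term n r % 2 ≡ 𝟙 (r ≤? n mod2^ suc k)
  term%2′ with r ≤? n mod2^ suc k
  ... | yes r≤ = 2∤⇒%2≡1 (term n r) λ 2∣t → <⇒≱ (2∣term⇒ {k} 2^k≤r r<2^ n 2∣t) r≤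
  ... | no r≰  = n∣m⇒m%n≡0 (term n r) 2 (⇒2∣term {k} 2^k≤r r<2^ n (≰⇒> r≰))

-- Sums

sum-applyUpTo-suc : ∀ f n → sum (applyUpTo f (suc n)) ≡ sum (applyUpTo f n) + f n
sum-applyUpTo-suc f n = begin
  sum (applyUpTo f (suc n))             ≡⟨ cong sum (applyUpTo-∷ʳ f n) ⟨
  sum (applyUpTo f n ∷ʳ f n)      ≡⟨ sum-++ (applyUpTo f n) (f n ∷ []) ⟩
  sum (applyUpTo f n) + (f n + 0)       ≡⟨ cong (sum (applyUpTo f n) +_) (+-identityʳ (f n)) ⟩
  sum (applyUpTo f n) + f n             ∎
  where open ≡-Reasoning

sum-cong-% : ∀ (f g : ℕ → ℕ) d .{{_ : NonZero d}} → (∀ i → f i % d ≡ g i % d) →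
             ∀ n → sum (applyUpTo f n) % d ≡ sum (applyUpTo g n) % d
sum-cong-% f g d f≡g zero = refl
sum-cong-% f g d f≡g (suc n) = begin
  (f 0 + Σf) % d            ≡⟨ %-distribˡ-+ (f 0) Σf d ⟩
  (f 0 % d + Σf % d) % d    ≡⟨ cong₂ (λ x y → (x + y) % d) (f≡g 0) Σf≡Σg ⟩
  (g 0 % d + Σg % d) % d    ≡⟨ %-distribˡ-+ (g 0) Σg d ⟨
  (g 0 + Σg) % d            ∎
  where
  open ≡-Reasoning
  Σf = sum (applyUpTo (f ∘ suc) n)
  Σg = sum (applyUpTo (g ∘ suc) n)
  Σf≡Σg : Σf % d ≡ Σg % d
  Σf≡Σg = sum-cong-% (f ∘ suc) (g ∘ suc) d (f≡g ∘ suc) n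

sum-cong : ∀ {f g : ℕ → ℕ} → (∀ i → f i ≡ g i) →
           ∀ n → sum (applyUpTo f n) ≡ sum (applyUpTo g n)
sum-cong f≡g zero    = refl
sum-cong f≡g (suc n) = cong₂ _+_ (f≡g 0) (sum-cong (f≡g ∘ suc) n)

sum-0 : ∀ n → sum (applyUpTo (λ _ → 0) n) ≡ 0
sum-0 zero    = refl
sum-0 (suc n) = sum-0 n

pair : (ℕ → ℕ) → ℕ → ℕ
pair f q = f (q * 2) + f (suc (q * 2))

sum-*2 : ∀ f n → sum (applyUpTo f (n * 2)) ≡ sum (applyUpTo (pair f) n)
sum-*2 f zero    = refl
sum-*2 f (suc n) = trans (sym (+-assoc (f 0) (f 1) _))
  (cong (f 0 + f 1 +_) (sum-*2 (f ∘ 2+) n))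

-- For `d = 1` the indices already split into pairs; for `d = 0` the last one lacks a partner, and
-- the vanishing next value supplies it.
sum-pair : ∀ f (d : Bit) j → f (suc (toℕ d + j * 2)) ≡ 0 →
           sum (applyUpTo f (suc (toℕ d + j * 2))) ≡ sum (applyUpTo (pair f) (suc j))
sum-pair f zero j f≡0 = begin
  sum (applyUpTo f (suc (j * 2)))                    ≡⟨ +-identityʳ _ ⟨
  sum (applyUpTo f (suc (j * 2))) + 0                ≡⟨ cong (sum (applyUpTo f (suc (j * 2))) +_) f≡0 ⟨
  sum (applyUpTo f (suc (j * 2))) + f (suc (j * 2))  ≡⟨ sum-applyUpTo-suc f (suc (j * 2)) ⟨
  sum (applyUpTo f (suc j * 2))                      ≡⟨ sum-*2 f (suc j) ⟩
  sum (applyUpTo (pair f) (suc j))                   ∎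
  where open ≡-Reasoning
sum-pair f (suc zero) j _ = sum-*2 f (suc j)

-- Parities of pairs of consecutive terms

a%2 : ∀ (d : Bit) j → a (toℕ d + j * 2) % 2 ≡
      sum (applyUpTo (pair (oddTerm (toℕ d + j * 2))) (suc j)) % 2
a%2 d j = trans (sum-cong-% (term n) (oddTerm n) 2 term≡oddTerm[%2] (suc n))
  -- The padding value at `suc n` is `0`, since a remainder of `n` is at most `n`.
  (cong (_% 2) (sum-pair (oddTerm n) d j (𝟙-no 1+n≰mod (suc n ≤? n mod2^ bits (suc n)))))
  where
  n = toℕ d + j * 2
  term≡oddTerm[%2] : ∀ r → term n r % 2 ≡ oddTerm n r % 2
  term≡oddTerm[%2] r = trans (sym (m%n%n≡m%n (term n r) 2)) (cong (_% 2) (term%2 n r))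
  1+n≰mod : ¬ suc n ≤ n mod2^ bits (suc n)
  1+n≰mod n<mod = <⇒≱ n<mod (mod2^≤ n (bits (suc n)))

oddTerm-even : ∀ (d : Bit) j q →
  oddTerm (toℕ d + j * 2) (q * 2) ≡ 𝟙 (q * 2 ≤? toℕ d + j mod2^ bits q * 2)
-- Doubling lengthens only a positive `q`; at `0` both inequalities hold trivially.
oddTerm-even d j zero =
  trans (𝟙-yes z≤n (0 ≤? (toℕ d + j * 2) mod2^ bits 0))
        (sym (𝟙-yes z≤n (0 ≤? toℕ d + j mod2^ bits 0 * 2)))
oddTerm-even d j q@(suc q′) = cong (λ x → 𝟙 (q * 2 ≤? x))
  (trans (cong ((toℕ d + j * 2) mod2^_) (bits-even q′)) (mod2^-suc d j (bits q)))

oddTerm-odd : ∀ (d : Bit) j q →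
  oddTerm (toℕ d + j * 2) (suc (q * 2)) ≡ 𝟙 (suc (q * 2) ≤? toℕ d + j mod2^ bits q * 2)
oddTerm-odd d j q = cong (λ x → 𝟙 (suc (q * 2) ≤? x))
  (trans (cong ((toℕ d + j * 2) mod2^_) (bits-odd q)) (mod2^-suc d j (bits q)))

m*2≤1+n*2⇒m≤n : ∀ m n → m * 2 ≤ suc (n * 2) → m ≤ n
m*2≤1+n*2⇒m≤n m n m*2≤ = ≮⇒≥ λ n<m → <⇒≱ (*-monoˡ-≤ 2 n<m) m*2≤

-- Against the odd bound `suc (x * 2)`, both `q * 2` and `suc (q * 2)` fit exactly when `q ≤ x`, so
-- the two indicators agree.
pair-oddTerm-odd : ∀ j q → pair (oddTerm (suc (j * 2))) q % 2 ≡ 0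
pair-oddTerm-odd j q = begin
  pair (oddTerm (suc (j * 2))) q % 2
    ≡⟨ cong₂ (λ u v → (u + v) % 2) (oddTerm-even 1b j q) (oddTerm-odd 1b j q) ⟩
  (𝟙 (q * 2 ≤? suc (x * 2)) + v) % 2
    ≡⟨ cong (λ u → (u + v) % 2) (𝟙-cong
         (λ le → s≤s (*-monoˡ-≤ 2 (m*2≤1+n*2⇒m≤n q x le)))
         (≤-trans (n≤1+n _))
         (q * 2 ≤? suc (x * 2)) (suc (q * 2) ≤? suc (x * 2))) ⟩
  (v + v) % 2
    ≡⟨ cong (_% 2) (n*2≡n+n v) ⟨
  v * 2 % 2
    ≡⟨ m*n%n≡0 v 2 ⟩
  0 ∎
  where
  open ≡-Reasoning
  x = j mod2^ bits q
  v = 𝟙 (suc (q * 2) ≤? suc (x * 2))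

𝟙≤+𝟙<≡𝟙≡[%2] : ∀ m n → (𝟙 (m ≤? n) + 𝟙 (m <? n)) % 2 ≡ 𝟙 (m ≟ n) % 2
𝟙≤+𝟙<≡𝟙≡[%2] m n with <-cmp m n
... | tri< m<n m≢n _ = trans
  (cong₂ (λ u v → (u + v) % 2) (𝟙-yes (<⇒≤ m<n) (m ≤? n)) (𝟙-yes m<n (m <? n)))
  (cong (_% 2) (sym (𝟙-no m≢n (m ≟ n))))
... | tri≈ m≮n m≡n _ = cong (_% 2) (trans
  (cong₂ _+_ (𝟙-yes (≤-reflexive m≡n) (m ≤? n)) (𝟙-no m≮n (m <? n)))
  (sym (𝟙-yes m≡n (m ≟ n))))
... | tri> m≮n m≢n n<m = cong (_% 2) (trans
  (cong₂ _+_ (𝟙-no (<⇒≱ n<m) (m ≤? n)) (𝟙-no m≮n (m <? n)))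
  (sym (𝟙-no m≢n (m ≟ n))))

-- Tests whether `q` consists of the lowest digits of `j`, as many as `q` itself has.
isTruncation : ℕ → ℕ → ℕ
isTruncation j q = 𝟙 (q ≟ j mod2^ bits q)

pair-oddTerm-even : ∀ j q → pair (oddTerm (j * 2)) q % 2 ≡ isTruncation j q % 2
pair-oddTerm-even j q = trans
  (cong₂ (λ u v → (u + v) % 2)
    (trans (oddTerm-even 0b j q)
      (𝟙-cong (*-cancelʳ-≤ q x 2) (*-monoˡ-≤ 2) (q * 2 ≤? x * 2) (q ≤? x)))
    (trans (oddTerm-odd 0b j q)
      (𝟙-cong (*-cancelʳ-< 2 q x) (*-monoˡ-< 2) (q * 2 <? x * 2) (q <? x))))
  (𝟙≤+𝟙<≡𝟙≡[%2] q x)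
  where
  x = j mod2^ bits q

-- Counting truncations

-- The range up to `j` misses nothing, as a truncation of `j` is at most `j`.
truncations : ℕ → ℕ
truncations j = sum (applyUpTo (isTruncation j) (suc j))

m*2≢1+n*2 : ∀ m n → m * 2 ≢ suc (n * 2)
m*2≢1+n*2 m n = subst₂ (λ x y → x ≢ suc y) (*-comm 2 m) (*-comm 2 n) (even≢odd m n)

isTruncation-0 : ∀ j → isTruncation j 0 ≡ 1
isTruncation-0 j = 𝟙-yes (sym (n%1≡0 j)) (0 ≟ j mod2^ bits 0)

isTruncation-even : ∀ (d : Bit) j q′ → let q = suc q′ in
  isTruncation (toℕ d + j * 2) (q * 2) ≡ 𝟙 (q * 2 ≟ toℕ d + j mod2^ bits q * 2)
isTruncation-even d j q′ = cong (λ x → 𝟙 (suc q′ * 2 ≟ x))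
  (trans (cong ((toℕ d + j * 2) mod2^_) (bits-even q′)) (mod2^-suc d j (bits (suc q′))))

isTruncation-odd : ∀ (d : Bit) j q →
  isTruncation (toℕ d + j * 2) (suc (q * 2)) ≡ 𝟙 (suc (q * 2) ≟ toℕ d + j mod2^ bits q * 2)
isTruncation-odd d j q = cong (λ x → 𝟙 (suc (q * 2) ≟ x))
  (trans (cong ((toℕ d + j * 2) mod2^_) (bits-odd q)) (mod2^-suc d j (bits q)))

isTruncation-1 : ∀ (d : Bit) j → isTruncation (toℕ d + j * 2) 1 ≡ toℕ d
isTruncation-1 d j = trans (isTruncation-odd d j 0)
  (trans (cong (λ x → 𝟙 (1 ≟ toℕ d + x * 2)) (n%1≡0 j)) (𝟙[1≟d] d))
  where
  𝟙[1≟d] : ∀ (d : Bit) → 𝟙 (1 ≟ toℕ d + 0) ≡ toℕ d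
  𝟙[1≟d] zero       = refl
  𝟙[1≟d] (suc zero) = refl

-- Only the candidate with lowest digit `d` can be a truncation of `toℕ d + j * 2`, and removing
-- that digit leaves the test of `suc q` against `j`.
pair-isTruncation : ∀ (d : Bit) j q →
  pair (isTruncation (toℕ d + j * 2)) (suc q) ≡ isTruncation j (suc q)
pair-isTruncation d j q′ = trans
  (cong₂ _+_ (isTruncation-even d j q′) (isTruncation-odd d j q)) (go d)
  where
  q = suc q′
  x = j mod2^ bits q
  go : ∀ (d : Bit) → 𝟙 (q * 2 ≟ toℕ d + x * 2) + 𝟙 (suc (q * 2) ≟ toℕ d + x * 2) ≡ 𝟙 (q ≟ x)
  go zero = trans
    (cong₂ _+_ (𝟙-cong (*-cancelʳ-≡ q x 2) (cong (_* 2)) (q * 2 ≟ x * 2) (q ≟ x))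
               (𝟙-no (m*2≢1+n*2 x q ∘ sym) (suc (q * 2) ≟ x * 2)))
    (+-identityʳ _)
  go (suc zero) = cong₂ _+_
    (𝟙-no (m*2≢1+n*2 q x) (q * 2 ≟ suc (x * 2)))
    (𝟙-cong (λ eq → *-cancelʳ-≡ q x 2 (suc-injective eq)) (cong (λ i → suc (i * 2)))
            (suc (q * 2) ≟ suc (x * 2)) (q ≟ x))

-- The candidates `0` and `1` contribute `1 + toℕ d`; the later pairs match the nonzero truncations
-- of `j`.
truncations-∷ : ∀ (d : Bit) j → truncations (toℕ d + j * 2) ≡ toℕ d + truncations j
truncations-∷ d j = begin
  truncations n
    ≡⟨ sum-pair (isTruncation n) d j (𝟙-no 1+n≢mod (suc n ≟ n mod2^ bits (suc n))) ⟩
  (isTruncation n 0 + isTruncation n 1) + sum (applyUpTo (pair (isTruncation n) ∘ suc) j)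
    ≡⟨ cong₂ _+_ (cong₂ _+_ (isTruncation-0 n) (isTruncation-1 d j)) (sum-cong (pair-isTruncation d j) j) ⟩
  (1 + toℕ d) + rest
    ≡⟨ cong (_+ rest) (+-comm 1 (toℕ d)) ⟩
  (toℕ d + 1) + rest
    ≡⟨ +-assoc (toℕ d) 1 rest ⟩
  toℕ d + (1 + rest)
    ≡⟨ cong (λ u → toℕ d + (u + rest)) (isTruncation-0 j) ⟨
  toℕ d + truncations j ∎
  where
  open ≡-Reasoning
  n = toℕ d + j * 2
  rest = sum (applyUpTo (isTruncation j ∘ suc) j)
  1+n≢mod : suc n ≢ n mod2^ bits (suc n)
  1+n≢mod eq = 1+n≰n (≤-trans (≤-reflexive eq) (mod2^≤ n (bits (suc n))))

truncations-fromDigits : ∀ (ds : Expansion 2) →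
  truncations (fromDigits ds) ≡ suc (length (filter (Fin._≟ 1b) ds))
truncations-fromDigits []              = refl
truncations-fromDigits (zero ∷ ds)     =
  trans (truncations-∷ 0b (fromDigits ds)) (truncations-fromDigits ds)
truncations-fromDigits (suc zero ∷ ds) =
  trans (truncations-∷ 1b (fromDigits ds)) (cong suc (truncations-fromDigits ds))

truncations≡1+s₂ : ∀ k → truncations k ≡ suc (s₂ k)
truncations≡1+s₂ k = trans (cong truncations (sym (proj₂ (toDigits 2 k))))
  (truncations-fromDigits (proj₁ (toDigits 2 k)))

-- Parity of `a` at even and odd arguments

[1+s₂]%2≡t̄%2 : ∀ k → suc (s₂ k) % 2 ≡ t̄ k % 2
[1+s₂]%2≡t̄%2 k with 2 ∣? s₂ k
... | yes 2∣s = %-remove-+ʳ 1 2∣s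
... | no 2∤s  = trans (%-distribˡ-+ 1 (s₂ k) 2) (cong (λ u → (1 + u) % 2) (2∤⇒%2≡1 (s₂ k) 2∤s))

a[2k]%2 : ∀ k → a (k * 2) % 2 ≡ t̄ k % 2
a[2k]%2 k = begin
  a (k * 2) % 2
    ≡⟨ a%2 0b k ⟩
  sum (applyUpTo (pair (oddTerm (k * 2))) (suc k)) % 2
    ≡⟨ sum-cong-% (pair (oddTerm (k * 2))) (isTruncation k) 2 (pair-oddTerm-even k) (suc k) ⟩
  truncations k % 2
    ≡⟨ cong (_% 2) (truncations≡1+s₂ k) ⟩
  suc (s₂ k) % 2
    ≡⟨ [1+s₂]%2≡t̄%2 k ⟩
  t̄ k % 2 ∎
  where open ≡-Reasoning

a[1+2k]%2 : ∀ k → a (suc (k * 2)) % 2 ≡ 0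
a[1+2k]%2 k = begin
  a (suc (k * 2)) % 2
    ≡⟨ a%2 1b k ⟩
  sum (applyUpTo (pair (oddTerm n)) (suc k)) % 2
    ≡⟨ sum-cong-% (pair (oddTerm n)) (λ _ → 0) 2 (pair-oddTerm-odd k) (suc k) ⟩
  sum (applyUpTo (λ _ → 0) (suc k)) % 2
    ≡⟨ cong (_% 2) (sum-0 (suc k)) ⟩
  0 ∎
  where
  open ≡-Reasoning
  n = suc (k * 2)

lemma8 : ∀ (n : ℕ) → a n % 2 ≡ m n % 2
lemma8 n with 2 ∣? n
-- The definition of `m` makes the same case distinction, so `m n` reduces to `t̄ k` here and to `0`
-- in the other case.
... | yes (divides k refl) = a[2k]%2 k
... | no 2∤n = subst (λ i → a i % 2 ≡ 0) (sym n≡1+[n/2]*2) (a[1+2k]%2 (n / 2))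
  where
  n≡1+[n/2]*2 : n ≡ suc (n / 2 * 2)
  n≡1+[n/2]*2 = trans (m≡m%n+[m/n]*n n 2) (cong (_+ n / 2 * 2) (2∤⇒%2≡1 n 2∤n))
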